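{- In the uniform random temporal graph where the underlying graph $G$ is the complete graph on $n$ vertices and the labels are chosen from $\{1,2,\ldots,\alpha\}$ with $\alpha\ge 4$, one can delete all but $\Theta(n\log n+\log^2 n)$ labels without violating TC, with probability at least $1-\frac{1}{n^2}$.
   Context: A uniform random temporal graph is a graph $G$ on $n$ vertices, each edge of which receives exactly one label, chosen uniformly at random from $\{1,2,\ldots,\alpha\}$, $\alpha\in\mathbb{N}^*$, independently of the labels of all other edges. A $(u,v)$-journey is a path from $u$ to $v$ whose successive edges carry strictly increasing labels. A labelled graph satisfies TC (is temporally connected) if for every ordered pair of distinct vertices $u,v$ there is a $(u,v)$-journey. Deleting the label of an edge makes the edge unusable in journeys. -}

module Defs where

open import Data.Fin as Fin using (Fin; _<_; _<?_; _≟_)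
open import Data.Fin.Properties using (any?; all?; injective⇒≤)
open import Data.Fin.Subset using (Subset; ∣_∣) renaming (_∈_ to _∈ₛ_)
open import Data.Fin.Subset.Properties using (anySubset?) renaming (_∈?_ to _∈ₛ?_)
open import Data.Integer using (+_)
open import Data.List using (List; []; _∷_; length; map; filter; lookup; allFin; cartesianProduct; cartesianProductWith)
open import Data.List.Membership.Propositional.Properties using (∈-lookup)
open import Data.List.Relation.Unary.All as All using (All)
open import Data.List.Relation.Unary.AllPairs using (_∷_; allPairs?)
open import Data.List.Relation.Unary.Linked using (Linked; linked?)
open import Data.List.Relation.Unary.Unique.Propositional using (Unique)
open import Data.Nat as ℕ using (ℕ; zero; suc; _*_; _^_; _≤_; z≤n; s≤s; NonZero)
import Data.Nat.Properties as ℕ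
open import Data.Product using (Σ; ∃; ∃-syntax; _×_; _,_)
open import Data.Product.Properties using (≡-dec)
open import Data.Rational.Unnormalised using (ℚᵘ; _/_)
open import Data.Sum using (_⊎_; inj₁; inj₂)
open import Data.Vec as Vec using (Vec)
open import Function.Base using (_∘_)
open import Relation.Binary.Definitions using (Decidable; Symmetric)
open import Relation.Binary.PropositionalEquality using (_≡_; _≢_; refl; sym; cong)
open import Relation.Nullary using (¬_; Dec; yes; no; ¬?; contradiction)
open import Relation.Nullary.Decidable using (map′; _×-dec_; _→-dec_; _⊎-dec_)
import Relation.Unary as U

-- f = Θ(g).  For functions ℕ → ℕ, natural-number constants lose no
-- generality: g n ≤ c * f n is f n ≥ (1/c) g n.

_∈Θ_ : (ℕ → ℕ) → (ℕ → ℕ) → Set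
f ∈Θ g = ∃[ c ] ∃[ d ] ∃[ n₀ ] ∀ n → n₀ ≤ n → g n ≤ c * f n × f n ≤ d * g n

record Graph (n : ℕ) : Set₁ where
  field
    Adj     : Fin n → Fin n → Set
    adj?    : Decidable Adj
    adj-sym : Symmetric Adj
    irrefl  : ∀ {v} → ¬ Adj v v

completeGraph : ∀ n → Graph n
completeGraph n = record
  { Adj     = _≢_
  ; adj?    = λ u v → ¬? (u ≟ v)
  ; adj-sym = _∘ sym
  ; irrefl  = λ v≢v → v≢v refl
  }

module _ {n : ℕ} (G : Graph n) where
  open Graph G

  -- Every undirected edge is listed once, from its smaller endpoint.
  edgeList : List (Fin n × Fin n)
  edgeList = filter (λ (u , v) → (u <? v) ×-dec adj? u v)
                    (cartesianProduct (allFin n) (allFin n))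

  #edges : ℕ
  #edges = length edgeList

  Edge : Set
  Edge = Fin #edges

  Joins : Edge → Fin n → Fin n → Set
  Joins e u v = lookup edgeList e ≡ (u , v) ⊎ lookup edgeList e ≡ (v , u)

  data Walk : Fin n → Fin n → Set where
    stop : ∀ {v} → Walk v v
    step : ∀ {u v w} (e : Edge) → Joins e u v → Walk v w → Walk u w

  vertices : ∀ {u v} → Walk u v → List (Fin n)
  vertices {u} stop         = u ∷ []
  vertices {u} (step _ _ p) = u ∷ vertices p

  edges : ∀ {u v} → Walk u v → List Edge
  edges stop         = []
  edges (step e _ p) = e ∷ edges p

  -- The labels 1, …, α are represented by Fin α; only their order matters.
  Labelling : ℕ → Set
  Labelling α = Vec (Fin α) #edges

  module _ {α : ℕ} (ℓ : Labelling α) where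

    -- K is the set of edges whose label has not been deleted.
    record Journey (K : Subset #edges) (u v : Fin n) : Set where
      field
        walk       : Walk u v
        isPath     : Unique (vertices walk)
        labelled   : All (_∈ₛ K) (edges walk)
        increasing : Linked _<_ (map (Vec.lookup ℓ) (edges walk))

    TC : Subset #edges → Set
    TC K = ∀ u v → u ≢ v → Journey K u v

    CanDeleteAllBut : ℕ → Set
    CanDeleteAllBut k = ∃[ K ] (∣ K ∣ ≡ k × TC K)

vectors : ∀ α m → List (Vec (Fin α) m)
vectors α zero    = Vec.[] ∷ []
vectors α (suc m) = cartesianProductWith Vec._∷_ (allFin α) (vectors α m)

-- Independent uniform labels: each of the α ^ #edges labellings is equally
-- likely.

Pr : ∀ {n} (G : Graph n) (α : ℕ) .{{_ : NonZero α}}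
     {P : Labelling G α → Set} → U.Decidable P → ℚᵘ
Pr G α P? = _/_ (+ length (filter P? (vectors α (#edges G)))) (α ^ #edges G)
                {{ℕ.m^n≢0 α (#edges G)}}

-- The remainder decides CanDeleteAllBut, so that its probability is defined.

Unique⇒lookup-injective : ∀ {A : Set} {xs : List A} → Unique xs →
                          ∀ {i j} → lookup xs i ≡ lookup xs j → i ≡ j
Unique⇒lookup-injective (_ ∷ _) {Fin.zero} {Fin.zero} _ = refl
Unique⇒lookup-injective {xs = _ ∷ xs} (x∉ ∷ _) {Fin.zero} {Fin.suc j} eq =
  contradiction eq (All.lookup x∉ (∈-lookup {xs = xs} j))
Unique⇒lookup-injective {xs = _ ∷ xs} (x∉ ∷ _) {Fin.suc i} {Fin.zero} eq =
  contradiction (sym eq) (All.lookup x∉ (∈-lookup {xs = xs} i))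
Unique⇒lookup-injective (_ ∷ us) {Fin.suc i} {Fin.suc j} eq =
  cong Fin.suc (Unique⇒lookup-injective us eq)

Unique⇒length≤ : ∀ {n} {xs : List (Fin n)} → Unique xs → length xs ≤ n
Unique⇒length≤ us = injective⇒≤ (Unique⇒lookup-injective us)

module _ {n : ℕ} (G : Graph n) where

  joins? : ∀ e u v → Dec (Joins G e u v)
  joins? e u v = ≡-dec _≟_ _≟_ (lookup (edgeList G) e) (u , v)
           ⊎-dec ≡-dec _≟_ _≟_ (lookup (edgeList G) e) (v , u)

  boundedWalk? : ∀ k u v {P : List (Fin n) → List (Edge G) → Set} →
                 (∀ vs es → Dec (P vs es)) →
                 Dec (Σ (Walk G u v) λ p →
                      length (vertices G p) ≤ k × P (vertices G p) (edges G p))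
  boundedWalk? zero u v P? = no λ { (stop , () , _) ; (step _ _ _ , () , _) }
  boundedWalk? (suc k) u v {P} P? = map′ to from (stop? ⊎-dec step?)
    where
    stop? : Dec (u ≡ v × P (u ∷ []) [])
    stop? = (u ≟ v) ×-dec P? _ _

    Step : Set
    Step = ∃[ e ] ∃[ w ] (Joins G e u w × Σ (Walk G w v) λ p →
             length (vertices G p) ≤ k × P (u ∷ vertices G p) (e ∷ edges G p))

    step? : Dec Step
    step? = any? λ e → any? λ w → joins? e u w ×-dec
            boundedWalk? k w v (λ vs es → P? (u ∷ vs) (e ∷ es))

    Goal : Set
    Goal = Σ (Walk G u v) λ p →
           length (vertices G p) ≤ suc k × P (vertices G p) (edges G p)

    to : (u ≡ v × P (u ∷ []) []) ⊎ Step → Goal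
    to (inj₁ (refl , h))                 = stop , s≤s z≤n , h
    to (inj₂ (e , w , j , p , p≤k , h)) = step e j p , s≤s p≤k , h

    from : Goal → (u ≡ v × P (u ∷ []) []) ⊎ Step
    from (stop , _ , h)               = inj₁ (refl , h)
    from (step e j p , s≤s p≤k , h) = inj₂ (e , _ , j , p , p≤k , h)

  module _ {α : ℕ} (ℓ : Labelling G α) where

    journey? : ∀ K u v → Dec (Journey G ℓ K u v)
    journey? K u v = map′
      (λ (p , _ , us , ks , inc) →
        record { walk = p ; isPath = us ; labelled = ks ; increasing = inc })
      (λ J → let open Journey J in
        walk , Unique⇒length≤ isPath , isPath , labelled , increasing)
      (boundedWalk? n u v λ vs es →
        allPairs? (λ x y → ¬? (x ≟ y)) vs ×-dec
        All.all? (_∈ₛ? K) es ×-dec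
        linked? _<?_ (map (Vec.lookup ℓ) es))

    TC? : ∀ K → Dec (TC G ℓ K)
    TC? K = all? λ u → all? λ v → ¬? (u ≟ v) →-dec journey? K u v

  canDeleteAllBut? : ∀ {α} k → U.Decidable (λ (ℓ : Labelling G α) → CanDeleteAllBut G ℓ k)
  canDeleteAllBut? k ℓ = anySubset? λ K → (∣ K ∣ ℕ.≟ k) ×-dec TC? ℓ K

{-# OPTIONS --safe #-}

-- Let L = ⌊log₂ n⌋, let the hubs be the first k = 8 (1 + L) vertices, and keep
-- every edge that meets a hub: at most k n edges.  A pair with a hub is joined
-- by its own edge.  For two other vertices u, v and a hub s, the journey
-- u → s → v fails with probability (1 + 1/α) / 2 ≤ 5/8, independently over s,
-- and n² (5/8)^k ≤ n⁻² because (5/8)⁸ ≤ 1/16 and n < 2^(1 + L); so the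
-- union bound suffices.

module Submission where

open import Defs
open import Data.Integer as ℤ using (+_)
import Data.Integer.Properties as ℤ
open import Data.Nat using (ℕ; _+_; _*_; _^_; NonZero) renaming (_≤_ to _≤ⁿ_)
open import Data.Nat.Logarithm using (⌊log₂_⌋; ⌊log₂⌋-mono-≤; ⌊log₂[2^n]⌋≡n)
open import Data.Nat.Properties using (m^n≢0)
open import Data.Product using (∃-syntax; _×_)
open import Data.Rational.Unnormalised using (_/_; _-_; _≤_; 1ℚᵘ; *≤*)

open import Data.Bool using (true; false; if_then_else_)
open import Data.Fin as Fin using (Fin; zero; suc; toℕ; inject≤)
import Data.Fin.Properties as Fin
open import Data.Fin.Subset using (Subset; ∣_∣; _⊆_; inside; outside) renaming (_∈_ to _∈ₛ_)
open import Data.Fin.Subset.Properties using (∣p∣≤n)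
open import Data.List
  using (List; []; _∷_; _++_; length; map; filter; lookup; allFin; tabulate; cartesianProduct; cartesianProductWith)
open import Data.List.Membership.Propositional using (_∈_)
open import Data.List.Membership.Propositional.Properties using (∈-allFin; ∈-filter⁺; ∈-cartesianProduct⁺)
open import Data.List.Properties using (map-∘; map-++; map-tabulate; length-tabulate)
open import Data.List.Relation.Unary.All as All using (All; []; _∷_; all?)
import Data.List.Relation.Unary.All.Properties as All
open import Data.List.Relation.Unary.AllPairs using (AllPairs; []; _∷_)
import Data.List.Relation.Unary.AllPairs.Properties as AllPairs
import Data.List.Relation.Unary.Unique.Propositional.Properties as Unique
open import Data.List.Relation.Unary.Any using (here; there; index)
open import Data.List.Relation.Unary.Any.Properties using (lookup-index)
open import Data.List.Relation.Unary.Linked using ([-]; _∷_)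
open import Data.Nat as ℕ using (zero; suc; z≤n; s≤s; _⊓_)
open import Data.Nat.ListAction using (sum)
open import Data.Nat.ListAction.Properties using (sum-++)
import Data.Nat.Properties as ℕ
open import Data.Nat.Tactic.RingSolver using (solve-∀)
open import Data.Product using (_,_; proj₁; proj₂)
open import Data.Product.Properties using (≡-dec)
open import Data.Sum using (inj₁; inj₂)
open import Data.Unit using (tt)
open import Data.Vec as Vec using (Vec; _[_]≔_)
import Data.Vec.Properties as Vec
open import Function.Base using (_∘_; id)
open import Relation.Binary.Definitions using (tri<; tri≈; tri>)
open import Relation.Binary.PropositionalEquality
  using (_≡_; _≢_; refl; sym; trans; cong; cong₂; subst; subst₂)
open import Relation.Nullary using (¬_; Dec; does; yes; no; ¬?; contradiction)
open import Relation.Nullary.Decidable using (_×-dec_; _→-dec_; dec-true; decidable-stable)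
import Relation.Unary as U

open ℕ.≤-Reasoning hiding (stop)

private
  variable
    A B C P Q : Set

-- Finite sums and indicators

∑ : List A → (A → ℕ) → ℕ
∑ xs f = sum (map f xs)

∑-cong : ∀ {f g : A → ℕ} xs → (∀ x → f x ≡ g x) → ∑ xs f ≡ ∑ xs g
∑-cong []       f≡g = refl
∑-cong (x ∷ xs) f≡g = cong₂ _+_ (f≡g x) (∑-cong xs f≡g)

∑-mono : ∀ {f g : A → ℕ} xs → (∀ x → f x ≤ⁿ g x) → ∑ xs f ≤ⁿ ∑ xs g
∑-mono []       f≤g = z≤n
∑-mono (x ∷ xs) f≤g = ℕ.+-mono-≤ (f≤g x) (∑-mono xs f≤g)

∑-const : ∀ (xs : List A) c → ∑ xs (λ _ → c) ≡ length xs * c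
∑-const []       c = refl
∑-const (x ∷ xs) c = cong (_ ℕ.+_) (∑-const xs c)

∑-+ : ∀ (xs : List A) f g → ∑ xs (λ x → f x + g x) ≡ ∑ xs f + ∑ xs g
∑-+ []       f g = refl
∑-+ (x ∷ xs) f g = begin-equality
  f x + g x + ∑ xs (λ x → f x + g x) ≡⟨ cong (f x + g x ℕ.+_) (∑-+ xs f g) ⟩
  f x + g x + (∑ xs f + ∑ xs g)      ≡⟨ interchange (f x) (g x) (∑ xs f) (∑ xs g) ⟩
  f x + ∑ xs f + (g x + ∑ xs g)      ∎
  where
  interchange : ∀ a b c d → a + b + (c + d) ≡ a + c + (b + d)
  interchange = solve-∀

∑-*ˡ : ∀ (xs : List A) c f → ∑ xs (λ x → c * f x) ≡ c * ∑ xs f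
∑-*ˡ []       c f = sym (ℕ.*-zeroʳ c)
∑-*ˡ (x ∷ xs) c f = trans (cong (c * f x ℕ.+_) (∑-*ˡ xs c f)) (sym (ℕ.*-distribˡ-+ c (f x) _))

∑-*ʳ : ∀ (xs : List A) f c → ∑ xs (λ x → f x * c) ≡ ∑ xs f * c
∑-*ʳ []       f c = refl
∑-*ʳ (x ∷ xs) f c = trans (cong (f x * c ℕ.+_) (∑-*ʳ xs f c)) (sym (ℕ.*-distribʳ-+ c (f x) _))

∑-swap : ∀ (xs : List A) (ys : List B) (f : A → B → ℕ) →
         ∑ xs (λ x → ∑ ys (f x)) ≡ ∑ ys (λ y → ∑ xs (λ x → f x y))
∑-swap []       ys f = sym (trans (∑-const ys 0) (ℕ.*-zeroʳ (length ys)))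
∑-swap (x ∷ xs) ys f = trans (cong (∑ ys (f x) ℕ.+_) (∑-swap xs ys f))
                             (sym (∑-+ ys (f x) (λ y → ∑ xs (λ x → f x y))))

∑-map : ∀ (g : A → B) xs f → ∑ (map g xs) f ≡ ∑ xs (f ∘ g)
∑-map g xs f = cong sum (sym (map-∘ xs))

∑-++ : ∀ (xs ys : List A) f → ∑ (xs ++ ys) f ≡ ∑ xs f + ∑ ys f
∑-++ xs ys f = trans (cong sum (map-++ f xs ys)) (sum-++ (map f xs) (map f ys))

∑-cartesianProductWith : ∀ (g : A → B → C) xs ys f →
  ∑ (cartesianProductWith g xs ys) f ≡ ∑ xs (λ x → ∑ ys (λ y → f (g x y)))
∑-cartesianProductWith g []       ys f = refl
∑-cartesianProductWith g (x ∷ xs) ys f = trans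
  (∑-++ (map (g x) ys) _ f)
  (cong₂ _+_ (∑-map (g x) ys f) (∑-cartesianProductWith g xs ys f))

∑-allFin-suc : ∀ n (f : Fin (suc n) → ℕ) → ∑ (allFin (suc n)) f ≡ f zero + ∑ (allFin n) (f ∘ suc)
∑-allFin-suc n f = cong (f zero ℕ.+_)
  (trans (cong (λ xs → ∑ xs f) (sym (map-tabulate id suc))) (∑-map suc (allFin n) f))

length-allFin : ∀ n → length (allFin n) ≡ n
length-allFin n = length-tabulate {n = n} id

∈⇒≤∑ : ∀ {x : A} {xs} f → x ∈ xs → f x ≤ⁿ ∑ xs f
∈⇒≤∑ f (here refl) = ℕ.m≤m+n _ _
∈⇒≤∑ f (there x∈)  = ℕ.≤-trans (∈⇒≤∑ f x∈) (ℕ.m≤n+m _ _)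

-- Probabilities are handled as counts of labellings, and counts as sums of indicators, so that the
-- argument stays in ℕ until the final comparison of rationals.
𝟙 : Dec P → ℕ
𝟙 P? = if does P? then 1 else 0

𝟙≤1 : (P? : Dec P) → 𝟙 P? ≤ⁿ 1
𝟙≤1 (yes _) = s≤s z≤n
𝟙≤1 (no _)  = z≤n

𝟙-true : (P? : Dec P) → P → 𝟙 P? ≡ 1
𝟙-true (yes _) _ = refl
𝟙-true (no ¬p) p = contradiction p ¬p

𝟙-false : (P? : Dec P) → ¬ P → 𝟙 P? ≡ 0
𝟙-false (yes p) ¬p = contradiction p ¬p
𝟙-false (no _)  _  = refl

𝟙-mono : (P? : Dec P) (Q? : Dec Q) → (P → Q) → 𝟙 P? ≤ⁿ 𝟙 Q?
𝟙-mono (yes p) Q? f = ℕ.≤-reflexive (sym (𝟙-true Q? (f p)))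
𝟙-mono (no _)  Q? f = z≤n

𝟙-¬ : (P? : Dec P) → 𝟙 P? + 𝟙 (¬? P?) ≡ 1
𝟙-¬ (yes _) = refl
𝟙-¬ (no _)  = refl

𝟙-all? : ∀ {R : A → Set} (R? : U.Decidable R) x xs →
         𝟙 (all? R? (x ∷ xs)) ≡ 𝟙 (R? x) * 𝟙 (all? R? xs)
𝟙-all? R? x xs with does (R? x) | does (all? R? xs)
... | false | _     = refl
... | true  | false = refl
... | true  | true  = refl

length-filter≡∑ : ∀ {R : A → Set} (R? : U.Decidable R) xs → length (filter R? xs) ≡ ∑ xs (𝟙 ∘ R?)
length-filter≡∑ R? [] = refl
length-filter≡∑ R? (x ∷ xs) with does (R? x)
... | true  = cong suc (length-filter≡∑ R? xs)
... | false = length-filter≡∑ R? xs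

∑-filter-≤ : ∀ {R : A → Set} (R? : U.Decidable R) xs f → ∑ (filter R? xs) f ≤ⁿ ∑ xs f
∑-filter-≤ R? [] f = z≤n
∑-filter-≤ R? (x ∷ xs) f with does (R? x)
... | true  = ℕ.+-monoʳ-≤ (f x) (∑-filter-≤ R? xs f)
... | false = ℕ.≤-trans (∑-filter-≤ R? xs f) (ℕ.m≤n+m _ (f x))

-- Only an inequality, because `k` may exceed `n`; every index then qualifies.
∑-toℕ< : ∀ n k → ∑ (allFin n) (λ i → 𝟙 (toℕ i ℕ.<? k)) ≤ⁿ k
∑-toℕ< zero    k       = z≤n
∑-toℕ< (suc n) zero    = ℕ.≤-reflexive (trans (∑-const (allFin (suc n)) 0) (ℕ.*-zeroʳ (length (allFin (suc n)))))
∑-toℕ< (suc n) (suc k) = begin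
  ∑ (allFin (suc n)) (λ i → 𝟙 (toℕ i ℕ.<? suc k)) ≡⟨ ∑-allFin-suc n (λ i → 𝟙 (toℕ i ℕ.<? suc k)) ⟩
  suc (∑ (allFin n) (λ i → 𝟙 (toℕ i ℕ.<? k)))     ≤⟨ s≤s (∑-toℕ< n k) ⟩
  suc k                                           ∎

-- Pairs of labels that do not increase.

#nonAscents : ℕ → ℕ
#nonAscents n = ∑ (allFin n) λ a → ∑ (allFin n) λ b → 𝟙 (¬? (a Fin.<? b))

-- Row `zero` of the table has the single non-ascent (0, 0), and each of the `n` other rows has one
-- in column `zero`; the rest is the table for `n`.
#nonAscents-suc : ∀ n → #nonAscents (suc n) ≡ 1 + (n + #nonAscents n)
#nonAscents-suc n = begin-equality
  #nonAscents (suc n)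
    ≡⟨ ∑-allFin-suc n (λ a → ∑ (allFin (suc n)) λ b → 𝟙 (¬? (a Fin.<? b))) ⟩
  ∑ (allFin (suc n)) (λ b → 𝟙 (¬? (zero {n} Fin.<? b)))
    + ∑ (allFin n) (λ a → ∑ (allFin (suc n)) λ b → 𝟙 (¬? (suc a Fin.<? b)))
    ≡⟨ cong₂ _+_
         (trans (∑-allFin-suc n (λ b → 𝟙 (¬? (zero {n} Fin.<? b))))
                (cong suc (trans (∑-const (allFin n) 0) (ℕ.*-zeroʳ (length (allFin n))))))
         (trans (∑-cong (allFin n) λ a → ∑-allFin-suc n (λ b → 𝟙 (¬? (suc a Fin.<? b))))
         (trans (∑-+ (allFin n) (λ _ → 1) λ a → ∑ (allFin n) λ b → 𝟙 (¬? (a Fin.<? b)))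
                (cong (_+ #nonAscents n)
                  (trans (∑-const (allFin n) 1) (trans (ℕ.*-identityʳ _) (length-allFin n)))))) ⟩
  1 + (n + #nonAscents n) ∎

-- Two independent uniform labels out of `n` thus fail to increase with probability (1 + 1/n)/2. The
-- same count, taken over vertices, later yields the number of edges of the complete graph.
2*#nonAscents : ∀ n → 2 * #nonAscents n ≡ n * n + n
2*#nonAscents zero    = refl
2*#nonAscents (suc n) = begin-equality
  2 * #nonAscents (suc n)             ≡⟨ cong (2 *_) (#nonAscents-suc n) ⟩
  2 * (1 + (n + #nonAscents n))       ≡⟨ distrib n (#nonAscents n) ⟩
  2 + 2 * n + 2 * #nonAscents n       ≡⟨ cong (2 + 2 * n ℕ.+_) (2*#nonAscents n) ⟩
  2 + 2 * n + (n * n + n)             ≡⟨ square n ⟩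
  suc n * suc n + suc n               ∎
  where
  distrib : ∀ n t → 2 * (1 + (n + t)) ≡ 2 + 2 * n + 2 * t
  distrib = solve-∀
  square : ∀ n → 2 + 2 * n + (n * n + n) ≡ (1 + n) * (1 + n) + (1 + n)
  square = solve-∀

-- The bound of 4 on the number of labels enters here: n ≤ n²/4 turns (n² + n)/2 into at most 5n²/8.
8*#nonAscents≤ : ∀ n → 4 ≤ⁿ n → 8 * #nonAscents n ≤ⁿ 5 * (n * n)
8*#nonAscents≤ n 4≤n = begin
  8 * #nonAscents n       ≡⟨ ℕ.*-assoc 4 2 (#nonAscents n) ⟩
  4 * (2 * #nonAscents n) ≡⟨ cong (4 *_) (2*#nonAscents n) ⟩
  4 * (n * n + n)         ≡⟨ ℕ.*-distribˡ-+ 4 (n * n) n ⟩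
  4 * (n * n) + 4 * n     ≤⟨ ℕ.+-monoʳ-≤ (4 * (n * n)) (ℕ.*-monoˡ-≤ n 4≤n) ⟩
  4 * (n * n) + n * n     ≡⟨ ℕ.+-comm (4 * (n * n)) (n * n) ⟩
  5 * (n * n)             ∎

-- Counting labellings

∑-vectors-suc : ∀ α m (f : Vec (Fin α) (suc m) → ℕ) →
  ∑ (vectors α (suc m)) f ≡ ∑ (allFin α) (λ a → ∑ (vectors α m) (λ v → f (a Vec.∷ v)))
∑-vectors-suc α m = ∑-cartesianProductWith Vec._∷_ (allFin α) (vectors α m)

∑-vectors-1 : ∀ α m → ∑ (vectors α m) (λ _ → 1) ≡ α ^ m
∑-vectors-1 α zero    = refl
∑-vectors-1 α (suc m) = begin-equality
  ∑ (vectors α (suc m)) (λ _ → 1)                  ≡⟨ ∑-vectors-suc α m (λ _ → 1) ⟩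
  ∑ (allFin α) (λ _ → ∑ (vectors α m) (λ _ → 1))   ≡⟨ ∑-const (allFin α) (∑ (vectors α m) (λ _ → 1)) ⟩
  length (allFin α) * ∑ (vectors α m) (λ _ → 1)    ≡⟨ cong₂ _*_ (length-allFin α) (∑-vectors-1 α m) ⟩
  α * α ^ m                                        ∎

-- Independence enters here: a coordinate may be drawn afresh, which lets the
-- indicators that do not look at it be factored out of the sum.
∑-resample : ∀ {α m} (i : Fin m) (f : Vec (Fin α) m → ℕ) →
  α * ∑ (vectors α m) f ≡ ∑ (vectors α m) (λ v → ∑ (allFin α) (λ a → f (v [ i ]≔ a)))
∑-resample {α} {suc m} zero f = begin-equality
  α * ∑ (vectors α (suc m)) f
    ≡⟨ cong (α *_) (trans (∑-vectors-suc α m f) (∑-swap (allFin α) (vectors α m) λ a v → f (a Vec.∷ v))) ⟩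
  α * S
    ≡⟨ cong (_* S) (length-allFin α) ⟨
  length (allFin α) * S
    ≡⟨ ∑-const (allFin α) S ⟨
  ∑ (allFin α) (λ _ → S)
    ≡⟨ ∑-vectors-suc α m (λ v → ∑ (allFin α) (λ a → f (v [ zero ]≔ a))) ⟨
  ∑ (vectors α (suc m)) (λ v → ∑ (allFin α) (λ a → f (v [ zero ]≔ a))) ∎
  where
  S : ℕ
  S = ∑ (vectors α m) λ v → ∑ (allFin α) λ a → f (a Vec.∷ v)
∑-resample {α} {suc m} (suc i) f = begin-equality
  α * ∑ (vectors α (suc m)) f
    ≡⟨ cong (α *_) (∑-vectors-suc α m f) ⟩
  α * ∑ (allFin α) (λ a → ∑ (vectors α m) (λ v → f (a Vec.∷ v)))
    ≡⟨ ∑-*ˡ (allFin α) α _ ⟨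
  ∑ (allFin α) (λ a → α * ∑ (vectors α m) (λ v → f (a Vec.∷ v)))
    ≡⟨ ∑-cong (allFin α) (λ a → ∑-resample i (λ v → f (a Vec.∷ v))) ⟩
  ∑ (allFin α) (λ a → ∑ (vectors α m) (λ v → ∑ (allFin α) (λ b → f (a Vec.∷ (v [ i ]≔ b)))))
    ≡⟨ ∑-vectors-suc α m (λ v → ∑ (allFin α) (λ b → f (v [ suc i ]≔ b))) ⟨
  ∑ (vectors α (suc m)) (λ v → ∑ (allFin α) (λ b → f (v [ suc i ]≔ b))) ∎

-- Independence of disjoint pairs of coordinates.

Avoids : ∀ {m} → Fin m → Fin m × Fin m → Set
Avoids i (x , y) = x ≢ i × y ≢ i

Disjoint : ∀ {m} → Fin m × Fin m → Fin m × Fin m → Set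
Disjoint (i , j) p = Avoids i p × Avoids j p

module _ {α m : ℕ} where

  NonAscent : Vec (Fin α) m → Fin m × Fin m → Set
  NonAscent v (i , j) = ¬ (Vec.lookup v i Fin.< Vec.lookup v j)

  nonAscent? : ∀ v → U.Decidable (NonAscent v)
  nonAscent? v (i , j) = ¬? (Vec.lookup v i Fin.<? Vec.lookup v j)

  NonAscent-update⁻ : ∀ v i a {p} → Avoids i p → NonAscent (v [ i ]≔ a) p → NonAscent v p
  NonAscent-update⁻ v i a (x≢i , y≢i) = subst₂ (λ b c → ¬ (b Fin.< c))
    (Vec.lookup∘update′ x≢i v a) (Vec.lookup∘update′ y≢i v a)

  #allNonAscent : List (Fin m × Fin m) → ℕ
  #allNonAscent ps = ∑ (vectors α m) (λ v → 𝟙 (all? (nonAscent? v) ps))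

  -- Coordinates `i` and `j` are both drawn afresh. The pairs in `ps` avoid them, so their condition
  -- falls back to the original `v`, while the fresh labels range over all pairs and contribute
  -- `#nonAscents α`.
  #allNonAscent-∷ : ∀ {i j ps} → i ≢ j → All (Disjoint (i , j)) ps →
    α * (α * #allNonAscent ((i , j) ∷ ps)) ≤ⁿ #nonAscents α * #allNonAscent ps
  #allNonAscent-∷ {i} {j} {ps} i≢j disj = begin
    α * (α * #allNonAscent ((i , j) ∷ ps))
      ≡⟨ cong (α *_) (∑-resample j _) ⟩
    α * ∑ (vectors α m) (λ v → ∑ (allFin α) λ b → 𝟙 (all? (nonAscent? (v [ j ]≔ b)) ((i , j) ∷ ps)))
      ≡⟨ ∑-resample i _ ⟩
    ∑ (vectors α m) (λ v → ∑ (allFin α) λ a → ∑ (allFin α) λ b →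
      𝟙 (all? (nonAscent? (v [ i ]≔ a [ j ]≔ b)) ((i , j) ∷ ps)))
      ≤⟨ ∑-mono (vectors α m) (λ v → ∑-mono (allFin α) λ a → ∑-mono (allFin α) λ b → split v a b) ⟩
    ∑ (vectors α m) (λ v → ∑ (allFin α) λ a → ∑ (allFin α) λ b →
      𝟙 (¬? (a Fin.<? b)) * 𝟙 (all? (nonAscent? v) ps))
      ≡⟨ ∑-cong (vectors α m) (λ v → trans
           (∑-cong (allFin α) λ a → ∑-*ʳ (allFin α) _ _)
           (∑-*ʳ (allFin α) _ _)) ⟩
    ∑ (vectors α m) (λ v → #nonAscents α * 𝟙 (all? (nonAscent? v) ps))
      ≡⟨ ∑-*ˡ (vectors α m) (#nonAscents α) _ ⟩
    #nonAscents α * #allNonAscent ps ∎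
    where
    split : ∀ v a b → 𝟙 (all? (nonAscent? (v [ i ]≔ a [ j ]≔ b)) ((i , j) ∷ ps))
                        ≤ⁿ 𝟙 (¬? (a Fin.<? b)) * 𝟙 (all? (nonAscent? v) ps)
    split v a b = begin
      𝟙 (all? (nonAscent? w) ((i , j) ∷ ps))
        ≡⟨ 𝟙-all? (nonAscent? w) (i , j) ps ⟩
      𝟙 (nonAscent? w (i , j)) * 𝟙 (all? (nonAscent? w) ps)
        ≤⟨ ℕ.*-mono-≤
             (𝟙-mono (nonAscent? w (i , j)) (¬? (a Fin.<? b))
               (subst₂ (λ b c → ¬ (b Fin.< c)) lookup-i (Vec.lookup∘update j (v [ i ]≔ a) b)))
             (𝟙-mono (all? (nonAscent? w) ps) (all? (nonAscent? v) ps)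
               (λ na → All.zipWith (λ ((avoids-i , avoids-j) , x) →
                   NonAscent-update⁻ v i a avoids-i (NonAscent-update⁻ (v [ i ]≔ a) j b avoids-j x))
                 (disj , na))) ⟩
      𝟙 (¬? (a Fin.<? b)) * 𝟙 (all? (nonAscent? v) ps) ∎
      where
      w : Vec (Fin α) m
      w = v [ i ]≔ a [ j ]≔ b
      -- The later update at `j` does not overwrite the fresh value at `i`, because `i ≢ j`.
      lookup-i : Vec.lookup w i ≡ a
      lookup-i = trans (Vec.lookup∘update′ i≢j (v [ i ]≔ a) b) (Vec.lookup∘update i v a)

  -- With denominators cleared, this is the probability bound (5/8) to the number of pairs. Each
  -- induction step redraws two coordinates, which accounts for the factor `α * α` that is
  -- cancelled.
  #allNonAscent-≤ : .{{_ : NonZero α}} → 4 ≤ⁿ α → ∀ {ps} →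
    All (λ (i , j) → i ≢ j) ps → AllPairs Disjoint ps →
    8 ^ length ps * #allNonAscent ps ≤ⁿ 5 ^ length ps * α ^ m
  #allNonAscent-≤ 4≤α [] [] = ℕ.+-monoˡ-≤ 0 (ℕ.≤-reflexive (∑-vectors-1 α m))
  #allNonAscent-≤ 4≤α {p ∷ ps} (i≢j ∷ irr) (disj ∷ disjs) =
    ℕ.*-cancelˡ-≤ (α * α) {{ℕ.m*n≢0 α α}} (begin
      α * α * (8 * e * x)             ≡⟨ pull α e x ⟩
      8 * e * (α * (α * x))           ≤⟨ ℕ.*-monoʳ-≤ (8 * e) (#allNonAscent-∷ i≢j disj) ⟩
      8 * e * (#nonAscents α * y)     ≡⟨ regroup e (#nonAscents α) y ⟩
      8 * #nonAscents α * (e * y)     ≤⟨ ℕ.*-mono-≤ (8*#nonAscents≤ α 4≤α) (#allNonAscent-≤ 4≤α irr disjs) ⟩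
      5 * (α * α) * (f * α ^ m)       ≡⟨ push α f (α ^ m) ⟩
      α * α * (5 * f * α ^ m)         ∎)
    where
    e f x y : ℕ
    e = 8 ^ length ps
    f = 5 ^ length ps
    x = #allNonAscent (p ∷ ps)
    y = #allNonAscent ps
    pull : ∀ α e x → α * α * (8 * e * x) ≡ 8 * e * (α * (α * x))
    pull = solve-∀
    regroup : ∀ e t y → 8 * e * (t * y) ≡ 8 * t * (e * y)
    regroup = solve-∀
    push : ∀ α f z → 5 * (α * α) * (f * z) ≡ α * α * (5 * f * z)
    push = solve-∀

-- The hub subgraph

-- `CanDeleteAllBut` fixes the exact number of kept labels, whereas the hub edges are only bounded
-- from above. Further edges can be kept without harm, so the set is padded to the prescribed size.
⊆-extend : ∀ {N} (p : Subset N) {m} → ∣ p ∣ ≤ⁿ m → m ≤ⁿ N → ∃[ q ] (p ⊆ q × ∣ q ∣ ≡ m)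
⊆-extend Vec.[] z≤n z≤n = Vec.[] , id , refl
⊆-extend (inside Vec.∷ p) (s≤s p≤m) (s≤s m≤N) =
  let q , p⊆q , eq = ⊆-extend p p≤m m≤N
  in inside Vec.∷ q , (λ { Vec.here → Vec.here ; (Vec.there x∈p) → Vec.there (p⊆q x∈p) }) , cong suc eq
⊆-extend (outside Vec.∷ p) {zero} p≤m m≤N =
  let q , p⊆q , eq = ⊆-extend p p≤m z≤n
  in outside Vec.∷ q , (λ { (Vec.there x∈p) → Vec.there (p⊆q x∈p) }) , eq
⊆-extend {suc N} (outside Vec.∷ p) {suc m} p≤m (s≤s m≤N) with ∣ p ∣ ℕ.≤? m
... | yes p≤m′ =
  let q , p⊆q , eq = ⊆-extend p p≤m′ m≤N
  in inside Vec.∷ q , (λ { (Vec.there x∈p) → Vec.there (p⊆q x∈p) }) , cong suc eq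
-- Here `p` already has `suc m` elements, so nothing is added.
... | no p≰m′ =
  outside Vec.∷ p , id , ℕ.≤-antisym p≤m (ℕ.≰⇒> p≰m′)

∣tabulate∣≡∑ : ∀ {R : A → Set} (R? : U.Decidable R) xs →
  ∣ Vec.tabulate (does ∘ R? ∘ lookup xs) ∣ ≡ ∑ xs (𝟙 ∘ R?)
∣tabulate∣≡∑ R? [] = refl
∣tabulate∣≡∑ R? (x ∷ xs) with does (R? x)
... | true  = cong suc (∣tabulate∣≡∑ R? xs)
... | false = ∣tabulate∣≡∑ R? xs

-- Edges of the complete graph and their hubs.

module _ (n : ℕ) where

  private
    G : Graph n
    G = completeGraph n

    E : List (Fin n × Fin n)
    E = edgeList G

    isEdge? : U.Decidable (λ ((u , v) : Fin n × Fin n) → u Fin.< v × u ≢ v)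
    isEdge? (u , v) = (u Fin.<? v) ×-dec Graph.adj? G u v

  -- The n² ordered pairs split into the edges, listed from the smaller endpoint, and the
  -- non-ascents, twice whose number is n² + n. Doubling and keeping `n` on the left avoid division
  -- and subtraction.
  2*#edges+n : 2 * #edges G + n ≡ n * n
  2*#edges+n = ℕ.+-cancelʳ-≡ (n * n) (2 * #edges G + n) (n * n) (begin-equality
    2 * #edges G + n + n * n             ≡⟨ shuffle (#edges G) n ⟩
    2 * #edges G + (n * n + n)           ≡⟨ cong (2 * #edges G ℕ.+_) (2*#nonAscents n) ⟨
    2 * #edges G + 2 * #nonAscents n     ≡⟨ ℕ.*-distribˡ-+ 2 (#edges G) (#nonAscents n) ⟨
    2 * (#edges G + #nonAscents n)       ≡⟨ cong (2 *_) total ⟩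
    2 * (n * n)                          ≡⟨ cong (n * n ℕ.+_) (ℕ.+-identityʳ (n * n)) ⟩
    n * n + n * n                        ∎)
    where
    shuffle : ∀ e n → 2 * e + n + n * n ≡ 2 * e + (n * n + n)
    shuffle = solve-∀

    -- In the complete graph u < v already implies adjacency, so the edge test agrees with the order
    -- test.
    complementary : ∀ u v → 𝟙 (isEdge? (u , v)) + 𝟙 (¬? (u Fin.<? v)) ≡ 1
    complementary u v = trans
      (cong (_+ 𝟙 (¬? (u Fin.<? v))) (ℕ.≤-antisym
        (𝟙-mono (isEdge? (u , v)) (u Fin.<? v) proj₁)
        (𝟙-mono (u Fin.<? v) (isEdge? (u , v)) (λ u<v → u<v , Fin.<⇒≢ u<v))))
      (𝟙-¬ (u Fin.<? v))

    total : #edges G + #nonAscents n ≡ n * n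
    total = begin-equality
      #edges G + #nonAscents n
        ≡⟨ cong (_+ #nonAscents n) (trans (length-filter≡∑ isEdge? (cartesianProduct (allFin n) (allFin n)))
             (∑-cartesianProductWith _,_ (allFin n) (allFin n) (𝟙 ∘ isEdge?))) ⟩
      ∑ (allFin n) (λ u → ∑ (allFin n) λ v → 𝟙 (isEdge? (u , v))) + #nonAscents n
        ≡⟨ ∑-+ (allFin n) _ _ ⟨
      ∑ (allFin n) (λ u → ∑ (allFin n) (λ v → 𝟙 (isEdge? (u , v)))
                        + ∑ (allFin n) (λ v → 𝟙 (¬? (u Fin.<? v))))
        ≡⟨ ∑-cong (allFin n) (λ u → trans (sym (∑-+ (allFin n) _ _))
             (∑-cong (allFin n) (complementary u))) ⟩
      ∑ (allFin n) (λ u → ∑ (allFin n) λ v → 1)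
        ≡⟨ ∑-const (allFin n) _ ⟩
      length (allFin n) * ∑ (allFin n) (λ v → 1)
        ≡⟨ cong₂ _*_ (length-allFin n) (trans (∑-const (allFin n) 1)
             (trans (ℕ.*-identityʳ _) (length-allFin n))) ⟩
      n * n ∎

  edgeBetween : ∀ {u v} → u Fin.< v → ∃[ e ] lookup E e ≡ (u , v)
  edgeBetween {u} {v} u<v = index uv∈E , sym (lookup-index uv∈E)
    where
    uv∈E : (u , v) ∈ E
    uv∈E = ∈-filter⁺ isEdge? (∈-cartesianProduct⁺ (∈-allFin u) (∈-allFin v)) (u<v , Fin.<⇒≢ u<v)

  -- The edge list is a filtered product of duplicate-free lists, hence duplicate-free itself.
  lookup-E-injective : ∀ {e e′ p} → lookup E e ≡ p → lookup E e′ ≡ p → e ≡ e′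
  lookup-E-injective eq eq′ = Unique⇒lookup-injective
    (Unique.filter⁺ isEdge? (Unique.cartesianProduct⁺ (Unique.allFin⁺ n) (Unique.allFin⁺ n)))
    (trans eq (sym eq′))

  edge⇒Journey : ∀ {α} (ℓ : Labelling G α) {K e u v} → u ≢ v → Joins G e u v → e ∈ₛ K → Journey G ℓ K u v
  edge⇒Journey ℓ u≢v joins e∈K = record
    { walk       = step _ joins stop
    ; isPath     = (u≢v ∷ []) ∷ [] ∷ []
    ; labelled   = e∈K ∷ []
    ; increasing = [-]
    }

  module _ (k : ℕ) where

    -- Testing the first endpoint suffices: edges are listed from the smaller endpoint and the hubs
    -- are an initial segment, so an edge that meets a hub starts at one.
    AtHub : Fin n × Fin n → Set
    AtHub (u , v) = toℕ u ℕ.< k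

    atHub? : U.Decidable AtHub
    atHub? (u , v) = toℕ u ℕ.<? k

    hubEdges : Subset (#edges G)
    hubEdges = Vec.tabulate (does ∘ atHub? ∘ lookup E)

    -- A crude count is enough: all ordered pairs that start at a hub, whether or not they are
    -- listed as edges.
    ∣hubEdges∣≤ : ∣ hubEdges ∣ ≤ⁿ k * n
    ∣hubEdges∣≤ = begin
      ∣ hubEdges ∣
        ≡⟨ ∣tabulate∣≡∑ atHub? E ⟩
      ∑ E (𝟙 ∘ atHub?)
        ≤⟨ ∑-filter-≤ isEdge? (cartesianProduct (allFin n) (allFin n)) _ ⟩
      ∑ (cartesianProduct (allFin n) (allFin n)) (𝟙 ∘ atHub?)
        ≡⟨ ∑-cartesianProductWith _,_ (allFin n) (allFin n) (𝟙 ∘ atHub?) ⟩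
      ∑ (allFin n) (λ u → ∑ (allFin n) (λ v → 𝟙 (toℕ u ℕ.<? k)))
        ≡⟨ ∑-cong (allFin n) (λ u → trans (∑-const (allFin n) _)
             (trans (cong (_* 𝟙 (toℕ u ℕ.<? k)) (length-allFin n)) (ℕ.*-comm n _))) ⟩
      ∑ (allFin n) (λ u → 𝟙 (toℕ u ℕ.<? k) * n)
        ≡⟨ ∑-*ʳ (allFin n) _ n ⟩
      ∑ (allFin n) (λ u → 𝟙 (toℕ u ℕ.<? k)) * n
        ≤⟨ ℕ.*-monoˡ-≤ n (∑-toℕ< n k) ⟩
      k * n ∎

    ∈-hubEdges : ∀ {e u v} → lookup E e ≡ (u , v) → toℕ u ℕ.< k → e ∈ₛ hubEdges
    ∈-hubEdges {e} eq u<k = Vec.lookup⇒[]= e hubEdges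
      (trans (Vec.lookup∘tabulate (does ∘ atHub? ∘ lookup E) e)
             (dec-true (atHub? (lookup E e)) (subst AtHub (sym eq) u<k)))

    -- Journeys through a hub and the union bound.

    module _ {α : ℕ} where

      -- Quantifying over all `e` and `e′` with these endpoints avoids choosing edges, which are
      -- listed this way only when `s` lies below `u` and `v`. A vertex that is not a hub satisfies
      -- the condition vacuously.
      NoRelay : (u v : Fin n) → Labelling G α → Fin n → Set
      NoRelay u v ℓ s = toℕ s ℕ.< k → ∀ e e′ → lookup E e ≡ (s , u) → lookup E e′ ≡ (s , v) →
                        NonAscent ℓ (e , e′)

      noRelay? : ∀ u v ℓ → U.Decidable (NoRelay u v ℓ)
      noRelay? u v ℓ s = (toℕ s ℕ.<? k) →-dec
        Fin.all? λ e → Fin.all? λ e′ →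
          (lookup E e ≟ₑ (s , u)) →-dec ((lookup E e′ ≟ₑ (s , v)) →-dec nonAscent? ℓ (e , e′))
        where
        _≟ₑ_ : (p q : Fin n × Fin n) → Dec (p ≡ q)
        _≟ₑ_ = ≡-dec Fin._≟_ Fin._≟_

      -- The conditions on `u` and `v` belong to the event itself, so that the union bound can run
      -- over all ordered pairs.
      Unserved : Fin n → Fin n → Labelling G α → Set
      Unserved u v ℓ = (k ≤ⁿ toℕ u × k ≤ⁿ toℕ v × u ≢ v) × (∀ s → NoRelay u v ℓ s)

      unserved? : ∀ u v → U.Decidable (Unserved u v)
      unserved? u v ℓ = ((k ℕ.≤? toℕ u) ×-dec (k ℕ.≤? toℕ v) ×-dec ¬? (u Fin.≟ v))
                        ×-dec Fin.all? (noRelay? u v ℓ)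

      relay⇒Journey : ∀ ℓ {K} → hubEdges ⊆ K → ∀ {u v s} → k ≤ⁿ toℕ u → k ≤ⁿ toℕ v → u ≢ v →
                      ¬ NoRelay u v ℓ s → Journey G ℓ K u v
      relay⇒Journey ℓ hub⊆K {u} {v} {s} k≤u k≤v u≢v ¬noRelay =
        let s<k : toℕ s ℕ.< k
            -- `NoRelay` is an implication from `toℕ s < k`, so its failure forces `s` to be a hub.
            s<k = decidable-stable (toℕ s ℕ.<? k) (λ s≮k → ¬noRelay (λ s<k → contradiction s<k s≮k))
            s<u = ℕ.<-≤-trans s<k k≤u
            s<v = ℕ.<-≤-trans s<k k≤v
            e  , eq  = edgeBetween s<u
            e′ , eq′ = edgeBetween s<v
        in record
          { walk       = step e (inj₂ eq) (step e′ (inj₁ eq′) stop)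
          ; isPath     = (Fin.<⇒≢ s<u ∘ sym ∷ u≢v ∷ []) ∷ (Fin.<⇒≢ s<v ∷ []) ∷ [] ∷ []
          ; labelled   = hub⊆K (∈-hubEdges eq s<k) ∷ hub⊆K (∈-hubEdges eq′ s<k) ∷ []
          ; increasing = decidable-stable (Vec.lookup ℓ e Fin.<? Vec.lookup ℓ e′)
              -- Any `f` and `f′` with the same endpoints are `e` and `e′` themselves, so a
              -- non-ascent there would make `NoRelay` hold.
              (λ e≮e′ → ¬noRelay λ _ f f′ eqf eqf′ →
                subst (NonAscent ℓ) (cong₂ _,_ (lookup-E-injective eq eqf) (lookup-E-injective eq′ eqf′)) e≮e′)
              ∷ [-]
          }

      hubEdge⇒Journey : ∀ (ℓ : Labelling G α) {K} → hubEdges ⊆ K → ∀ {u v} → u Fin.< v → toℕ u ℕ.< k →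
                        Journey G ℓ K u v × Journey G ℓ K v u
      hubEdge⇒Journey ℓ hub⊆K u<v u<k =
        let e , eq = edgeBetween u<v
            e∈K = hub⊆K (∈-hubEdges eq u<k)
        in edge⇒Journey ℓ (Fin.<⇒≢ u<v) (inj₁ eq) e∈K , edge⇒Journey ℓ (Fin.<⇒≢ u<v ∘ sym) (inj₂ eq) e∈K

      TC-hubEdges : ∀ ℓ {K} → hubEdges ⊆ K → (∀ u v → ¬ Unserved u v ℓ) → TC G ℓ K
      TC-hubEdges ℓ {K} hub⊆K served u v u≢v with Fin.<-cmp u v | toℕ u ℕ.<? k | toℕ v ℕ.<? k
      ... | tri≈ _ u≡v _ | _       | _       = contradiction u≡v u≢v
      ... | tri< u<v _ _ | yes u<k | _       = proj₁ (hubEdge⇒Journey ℓ hub⊆K u<v u<k)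
      -- If the larger endpoint is a hub, then so is the smaller one.
      ... | tri< u<v _ _ | no _    | yes v<k = proj₁ (hubEdge⇒Journey ℓ hub⊆K u<v (ℕ.<-trans u<v v<k))
      ... | tri> _ _ v<u | _       | yes v<k = proj₂ (hubEdge⇒Journey ℓ hub⊆K v<u v<k)
      ... | tri> _ _ v<u | yes u<k | no _    = proj₂ (hubEdge⇒Journey ℓ hub⊆K v<u (ℕ.<-trans v<u u<k))
      ... | _            | no u≮k  | no v≮k  =
        let k≤u = ℕ.≮⇒≥ u≮k
            k≤v = ℕ.≮⇒≥ v≮k
            s , ¬noRelay = Fin.¬∀⟶∃¬ n _ (noRelay? u v ℓ)
                             (λ noRelay → served u v ((k≤u , k≤v , u≢v) , noRelay))
        in relay⇒Journey ℓ hub⊆K k≤u k≤v u≢v ¬noRelay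

      -- For distinct `u` and `v` outside the hubs, the `k` relays use 2k different edges, so each
      -- one contributes a factor 5/8. For any other pair the event is impossible.
      #unserved-≤ : .{{_ : NonZero α}} → 4 ≤ⁿ α → ∀ u v →
        8 ^ k * ∑ (vectors α (#edges G)) (𝟙 ∘ unserved? u v) ≤ⁿ 5 ^ k * α ^ #edges G
      #unserved-≤ 4≤α u v with (k ℕ.≤? toℕ u) ×-dec (k ℕ.≤? toℕ v) ×-dec ¬? (u Fin.≟ v)
      ... | no ¬outer = begin
        8 ^ k * ∑ (vectors α (#edges G)) (𝟙 ∘ unserved? u v)
          ≡⟨ cong (8 ^ k *_) (trans
               (∑-cong (vectors α (#edges G)) (λ ℓ → 𝟙-false (unserved? u v ℓ) (¬outer ∘ proj₁)))
               (trans (∑-const (vectors α (#edges G)) 0) (ℕ.*-zeroʳ (length (vectors α (#edges G)))))) ⟩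
        8 ^ k * 0 ≡⟨ ℕ.*-zeroʳ (8 ^ k) ⟩
        0         ≤⟨ z≤n ⟩
        5 ^ k * α ^ #edges G ∎
      ... | yes (k≤u , k≤v , u≢v) = begin
        8 ^ k * ∑ (vectors α (#edges G)) (𝟙 ∘ unserved? u v)
          ≤⟨ ℕ.*-monoʳ-≤ (8 ^ k) (∑-mono (vectors α (#edges G)) λ ℓ →
               𝟙-mono (unserved? u v ℓ) (all? (nonAscent? ℓ) relays) (unserved⇒nonAscents ℓ)) ⟩
        8 ^ k * #allNonAscent relays
          ≤⟨ subst (λ j → 8 ^ j * #allNonAscent relays ≤ⁿ 5 ^ j * α ^ #edges G) (length-tabulate relay)
               (#allNonAscent-≤ 4≤α
                 (All.tabulate⁺ λ t eq → u≢v (cong proj₂ (same (to-u t) (to-v t) eq)))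
                 -- Every relay edge is listed with its hub first, so edges at distinct hubs differ
                 -- whatever their other endpoints.
                 (AllPairs.tabulate⁺ λ {t} {t′} t≢t′ →
                   let apart : ∀ {x y} → (hub t , x) ≢ (hub t′ , y)
                       apart eq = t≢t′ (Fin.inject≤-injective _ _ t t′ (cong proj₁ eq))
                   in ( (λ eq → apart (same (to-u t) (to-u t′) (sym eq)))
                      , (λ eq → apart (same (to-u t) (to-v t′) (sym eq))))
                    , ( (λ eq → apart (same (to-v t) (to-u t′) (sym eq)))
                      , (λ eq → apart (same (to-v t) (to-v t′) (sym eq)))))) ⟩
        5 ^ k * α ^ #edges G ∎
        where
        -- That `u` lies outside the hubs gives `k ≤ toℕ u < n`, so all `k` hubs exist.
        hub : Fin k → Fin n
        hub t = inject≤ t (ℕ.≤-trans k≤u (ℕ.<⇒≤ (Fin.toℕ<n u)))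

        hub<k : ∀ t → toℕ (hub t) ℕ.< k
        hub<k t = subst (ℕ._< k) (sym (Fin.toℕ-inject≤ t _)) (Fin.toℕ<n t)

        to-u : ∀ t → ∃[ e ] lookup E e ≡ (hub t , u)
        to-u t = edgeBetween (ℕ.<-≤-trans (hub<k t) k≤u)

        to-v : ∀ t → ∃[ e ] lookup E e ≡ (hub t , v)
        to-v t = edgeBetween (ℕ.<-≤-trans (hub<k t) k≤v)

        relay : Fin k → Edge G × Edge G
        relay t = proj₁ (to-u t) , proj₁ (to-v t)

        relays : List (Edge G × Edge G)
        relays = tabulate relay

        same : ∀ {p q} ((e , _) : ∃[ e ] lookup E e ≡ p) ((e′ , _) : ∃[ e ] lookup E e ≡ q) → e ≡ e′ → p ≡ q
        same (_ , eq) (_ , eq′) refl = trans (sym eq) eq′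

        unserved⇒nonAscents : ∀ ℓ → Unserved u v ℓ → All (NonAscent ℓ) relays
        unserved⇒nonAscents ℓ (_ , noRelay) = All.tabulate⁺ λ t →
          noRelay (hub t) (hub<k t) _ _ (proj₂ (to-u t)) (proj₂ (to-v t))

      -- Union bound over the n² ordered pairs: when no pair is unserved, the padded set of hub
      -- edges is temporally connected.
      #failures-≤ : .{{_ : NonZero α}} → 4 ≤ⁿ α →
        8 ^ k * ∑ (vectors α (#edges G)) (λ ℓ → 𝟙 (¬? (canDeleteAllBut? G (#edges G ⊓ (k * n)) ℓ)))
          ≤ⁿ n ^ 2 * (5 ^ k * α ^ #edges G)
      #failures-≤ 4≤α = begin
        8 ^ k * ∑ V (λ ℓ → 𝟙 (¬? (can? ℓ)))
          ≤⟨ ℕ.*-monoʳ-≤ (8 ^ k) (∑-mono V unionBound) ⟩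
        8 ^ k * ∑ V (λ ℓ → ∑ (allFin n) λ u → ∑ (allFin n) λ v → 𝟙 (unserved? u v ℓ))
          ≡⟨ cong (8 ^ k *_) (trans (∑-swap V (allFin n) _)
               (∑-cong (allFin n) λ u → ∑-swap V (allFin n) _)) ⟩
        8 ^ k * ∑ (allFin n) (λ u → ∑ (allFin n) λ v → ∑ V (𝟙 ∘ unserved? u v))
          ≡⟨ trans (sym (∑-*ˡ (allFin n) (8 ^ k) _)) (∑-cong (allFin n) λ u → sym (∑-*ˡ (allFin n) (8 ^ k) _)) ⟩
        ∑ (allFin n) (λ u → ∑ (allFin n) λ v → 8 ^ k * ∑ V (𝟙 ∘ unserved? u v))
          ≤⟨ ∑-mono (allFin n) (λ u → ∑-mono (allFin n) (#unserved-≤ 4≤α u)) ⟩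
        ∑ (allFin n) (λ u → ∑ (allFin n) λ v → c)
          ≡⟨ trans (∑-const (allFin n) _) (cong₂ _*_ (length-allFin n)
               (trans (∑-const (allFin n) c) (cong (_* c) (length-allFin n)))) ⟩
        n * (n * c)
          ≡⟨ square n c ⟩
        n ^ 2 * c ∎
        where
        V : List (Labelling G α)
        V = vectors α (#edges G)

        c : ℕ
        c = 5 ^ k * α ^ #edges G

        can? : U.Decidable (λ (ℓ : Labelling G α) → CanDeleteAllBut G ℓ (#edges G ⊓ (k * n)))
        can? = canDeleteAllBut? G (#edges G ⊓ (k * n))

        square : ∀ n c → n * (n * c) ≡ n * (n * 1) * c
        square = solve-∀

        unionBound : ∀ ℓ → 𝟙 (¬? (can? ℓ)) ≤ⁿ ∑ (allFin n) λ u → ∑ (allFin n) λ v → 𝟙 (unserved? u v ℓ)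
        unionBound ℓ with Fin.any? (λ u → Fin.any? λ v → unserved? u v ℓ)
        ... | yes (u , v , unserved) = begin
          𝟙 (¬? (can? ℓ))                                          ≤⟨ 𝟙≤1 (¬? (can? ℓ)) ⟩
          1                                                        ≡⟨ 𝟙-true (unserved? u v ℓ) unserved ⟨
          𝟙 (unserved? u v ℓ)                                      ≤⟨ ∈⇒≤∑ (λ v → 𝟙 (unserved? u v ℓ)) (∈-allFin v) ⟩
          ∑ (allFin n) (λ v → 𝟙 (unserved? u v ℓ))                 ≤⟨ ∈⇒≤∑ (λ u → ∑ (allFin n) λ v → 𝟙 (unserved? u v ℓ)) (∈-allFin u) ⟩
          ∑ (allFin n) (λ u → ∑ (allFin n) λ v → 𝟙 (unserved? u v ℓ)) ∎
        ... | no served =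
          -- The number of hub edges is at most both terms of the minimum, so padding reaches the
          -- minimum exactly.
          let K , hub⊆K , ∣K∣≡ = ⊆-extend hubEdges (ℕ.⊓-glb (∣p∣≤n hubEdges) ∣hubEdges∣≤) (ℕ.m⊓n≤m _ _)
              can = K , ∣K∣≡ , TC-hubEdges ℓ hub⊆K (λ u v unserved → served (u , v , unserved))
          in ℕ.≤-trans (ℕ.≤-reflexive (𝟙-false (¬? (can? ℓ)) (contradiction can))) z≤n

-- Asymptotics and the probability bound

-- Otherwise monotonicity of the logarithm would give 1 + L ≤ L for L = `⌊log₂ n ⌋`.
n<2^[1+⌊log₂n⌋] : ∀ n → n ℕ.< 2 ^ suc ⌊log₂ n ⌋
n<2^[1+⌊log₂n⌋] n = ℕ.≰⇒> λ 2^≤n → ℕ.<-irrefl refl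
  (subst (_≤ⁿ ⌊log₂ n ⌋) (⌊log₂[2^n]⌋≡n (suc ⌊log₂ n ⌋)) (⌊log₂⌋-mono-≤ 2^≤n))

⌊log₂n⌋<n : ∀ n .{{_ : NonZero n}} → ⌊log₂ n ⌋ ℕ.< n
⌊log₂n⌋<n (suc n) = s≤s (subst (⌊log₂ suc n ⌋ ≤ⁿ_) (⌊log₂[2^n]⌋≡n n) (⌊log₂⌋-mono-≤ (n<2^n n)))
  where
  n<2^n : ∀ n → n ℕ.< 2 ^ n
  n<2^n zero    = s≤s z≤n
  n<2^n (suc n) = ℕ.+-mono-≤ (ℕ.m^n>0 2 n) (ℕ.≤-trans (n<2^n n) (ℕ.m≤m+n _ 0))

#hubs : ℕ → ℕ
#hubs n = 8 * suc ⌊log₂ n ⌋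

-- One factor n² pays for the union bound, the other for the target failure probability. Their
-- product n⁴ is at most 16^l, and eight hubs gain (8/5)⁸ ≥ 16 for each unit of `l`.
n²*n²*5^#hubs≤8^#hubs : ∀ n → n ^ 2 * (n ^ 2 * 5 ^ #hubs n) ≤ⁿ 8 ^ #hubs n
n²*n²*5^#hubs≤8^#hubs n = begin
  n ^ 2 * (n ^ 2 * 5 ^ (8 * l))     ≡⟨ ℕ.*-assoc (n ^ 2) (n ^ 2) _ ⟨
  n ^ 2 * n ^ 2 * 5 ^ (8 * l)       ≡⟨ cong (_* 5 ^ (8 * l)) (ℕ.^-distribˡ-+-* n 2 2) ⟨
  n ^ 4 * 5 ^ (8 * l)               ≤⟨ ℕ.*-monoˡ-≤ (5 ^ (8 * l)) (ℕ.^-monoˡ-≤ 4 (ℕ.<⇒≤ (n<2^[1+⌊log₂n⌋] n))) ⟩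
  (2 ^ l) ^ 4 * 5 ^ (8 * l)         ≡⟨ cong₂ _*_ (trans (ℕ.^-*-assoc 2 l 4)
                                         (trans (cong (2 ^_) (ℕ.*-comm l 4)) (sym (ℕ.^-*-assoc 2 4 l))))
                                         (sym (ℕ.^-*-assoc 5 8 l)) ⟩
  (2 ^ 4) ^ l * (5 ^ 8) ^ l         ≡⟨ ^-distribʳ-* (2 ^ 4) (5 ^ 8) l ⟨
  -- The numerical fact is 6250000 ≤ 16777216, checked by evaluation.
  (2 ^ 4 * 5 ^ 8) ^ l               ≤⟨ ℕ.^-monoˡ-≤ l (ℕ.≤ᵇ⇒≤ (2 ^ 4 * 5 ^ 8) (8 ^ 8) tt) ⟩
  (8 ^ 8) ^ l                       ≡⟨ ℕ.^-*-assoc 8 8 l ⟩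
  8 ^ (8 * l)                       ∎
  where
  l : ℕ
  l = suc ⌊log₂ n ⌋
  ^-distribʳ-* : ∀ a b m → (a * b) ^ m ≡ a ^ m * b ^ m
  ^-distribʳ-* a b zero    = refl
  ^-distribʳ-* a b (suc m) = trans (cong (a * b *_) (^-distribʳ-* a b m)) (interchange a b (a ^ m) (b ^ m))
    where
    interchange : ∀ a b c d → a * b * (c * d) ≡ a * c * (b * d)
    interchange = solve-∀

-- The minimum takes care of small n, where the hub edges are all the edges or
-- the bound k n exceeds their number.
#kept : ℕ → ℕ
#kept n = #edges (completeGraph n) ⊓ (#hubs n * n)

-- Since L = `⌊log₂ n ⌋` is below n, the term L² is absorbed by nL. Both terms of the minimum are at
-- least nL/2: the hub bound is 8(1 + L)n, and the number of edges is n(n - 1)/2 with L ≤ n - 1.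
#kept∈Θ : #kept ∈Θ (λ n → n * ⌊log₂ n ⌋ + ⌊log₂ n ⌋ ^ 2)
-- The constant 4 covers nL + L² ≤ 2nL against nL/2. From n = 2 on, L ≥ 1, so 8(1 + L) ≤ 16L.
#kept∈Θ = 4 , 16 , 2 , λ n 2≤n → lower n {{ℕ.>-nonZero (ℕ.<⇒≤ 2≤n)}} , upper n 2≤n
  where
  lower : ∀ n .{{_ : NonZero n}} → n * ⌊log₂ n ⌋ + ⌊log₂ n ⌋ ^ 2 ≤ⁿ 4 * #kept n
  lower n = begin
    n * L + L ^ 2                         ≤⟨ ℕ.+-monoʳ-≤ (n * L) (ℕ.*-mono-≤ (ℕ.<⇒≤ (⌊log₂n⌋<n n)) (ℕ.≤-reflexive (ℕ.*-identityʳ L))) ⟩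
    n * L + n * L                         ≤⟨ ℕ.⊓-glb viaEdges viaHubs ⟩
    (4 * e) ⊓ (4 * (#hubs n * n))         ≡⟨ ℕ.*-distribˡ-⊓ 4 e (#hubs n * n) ⟨
    4 * #kept n                           ∎
    where
    L e : ℕ
    L = ⌊log₂ n ⌋
    e = #edges (completeGraph n)

    viaEdges : n * L + n * L ≤ⁿ 4 * e
    viaEdges = ℕ.≤-trans (ℕ.+-mono-≤ nL≤2e nL≤2e) (ℕ.≤-reflexive (sym (ℕ.*-distribʳ-+ e 2 2)))
      where
      nL≤2e : n * L ≤ⁿ 2 * e
      nL≤2e = ℕ.+-cancelʳ-≤ n (n * L) (2 * e) (begin
        n * L + n   ≡⟨ trans (ℕ.+-comm (n * L) n) (sym (ℕ.*-suc n L)) ⟩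
        n * suc L   ≤⟨ ℕ.*-monoʳ-≤ n (⌊log₂n⌋<n n) ⟩
        n * n       ≡⟨ 2*#edges+n n ⟨
        2 * e + n   ∎)

    viaHubs : n * L + n * L ≤ⁿ 4 * (#hubs n * n)
    -- The added term is what remains of 32n + 32nL after removing 2nL.
    viaHubs = ℕ.≤-trans (ℕ.m≤m+n _ (30 * (n * L) + 32 * n)) (ℕ.≤-reflexive (expand n L))
      where
      expand : ∀ n L → n * L + n * L + (30 * (n * L) + 32 * n) ≡ 4 * (8 * (1 + L) * n)
      expand = solve-∀

  upper : ∀ n → 2 ≤ⁿ n → #kept n ≤ⁿ 16 * (n * ⌊log₂ n ⌋ + ⌊log₂ n ⌋ ^ 2)
  upper n 2≤n = begin
    #kept n                 ≤⟨ ℕ.m⊓n≤n _ (#hubs n * n) ⟩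
    8 * (1 + L) * n         ≤⟨ ℕ.*-monoˡ-≤ n (ℕ.*-monoʳ-≤ 8 (ℕ.+-monoˡ-≤ L (⌊log₂⌋-mono-≤ 2≤n))) ⟩
    8 * (L + L) * n         ≡⟨ collect n L ⟩
    16 * (n * L)            ≤⟨ ℕ.*-monoʳ-≤ 16 (ℕ.m≤m+n (n * L) (L ^ 2)) ⟩
    16 * (n * L + L ^ 2)    ∎
    where
    L : ℕ
    L = ⌊log₂ n ⌋
    collect : ∀ n L → 8 * (L + L) * n ≡ 16 * (n * L)
    collect = solve-∀

-- With `g` good and `b` bad outcomes among `M`, the bound b/M ≤ 1/d passes to the complement by
-- cross-multiplication.
1-1/d≤g/M : ∀ d g b M .{{_ : NonZero d}} .{{_ : NonZero M}} → g + b ≡ M → d * b ≤ⁿ M →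
            1ℚᵘ - (+ 1) / d ≤ (+ g) / M
1-1/d≤g/M (suc d) g b (suc M) g+b≡M db≤M = *≤*
  -- Unnormalised subtraction evaluates 1 - 1/(suc d) to (d + 0)/suc (d + 0), whence the `+ 0`.
  (subst₂ ℤ._≤_ (ℤ.pos-* (d + 0) (suc M)) (ℤ.pos-* g (suc (d + 0)))
    (ℤ.+≤+ (subst (λ c → c * suc M ≤ⁿ g * suc c) (sym (ℕ.+-identityʳ d)) cleared)))
  where
  cleared : d * suc M ≤ⁿ g * suc d
  cleared = ℕ.+-cancelʳ-≤ (suc M) (d * suc M) (g * suc d) (begin
    d * suc M + suc M          ≡⟨ ℕ.+-comm (d * suc M) (suc M) ⟩
    suc d * suc M              ≡⟨ cong (suc d *_) g+b≡M ⟨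
    suc d * (g + b)            ≡⟨ ℕ.*-distribˡ-+ (suc d) g b ⟩
    suc d * g + suc d * b      ≤⟨ ℕ.+-mono-≤ (ℕ.≤-reflexive (ℕ.*-comm (suc d) g)) db≤M ⟩
    g * suc d + suc M          ∎)

#failures-≤-α^#edges : ∀ n α .{{_ : NonZero α}} → 4 ≤ⁿ α →
  n ^ 2 * ∑ (vectors α (#edges (completeGraph n))) (λ ℓ → 𝟙 (¬? (canDeleteAllBut? (completeGraph n) (#kept n) ℓ)))
    ≤ⁿ α ^ #edges (completeGraph n)
#failures-≤-α^#edges n α 4≤α = ℕ.*-cancelˡ-≤ (8 ^ k) {{m^n≢0 8 k}} (begin
  8 ^ k * (n ^ 2 * b)                   ≡⟨ pull (8 ^ k) (n ^ 2) b ⟩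
  n ^ 2 * (8 ^ k * b)                   ≤⟨ ℕ.*-monoʳ-≤ (n ^ 2) (#failures-≤ n k 4≤α) ⟩
  n ^ 2 * (n ^ 2 * (5 ^ k * M))         ≡⟨ regroup (n ^ 2) (5 ^ k) M ⟩
  n ^ 2 * (n ^ 2 * 5 ^ k) * M           ≤⟨ ℕ.*-monoˡ-≤ M (n²*n²*5^#hubs≤8^#hubs n) ⟩
  8 ^ k * M                             ∎)
  where
  k b M : ℕ
  k = #hubs n
  b = ∑ (vectors α (#edges (completeGraph n))) (λ ℓ → 𝟙 (¬? (canDeleteAllBut? (completeGraph n) (#kept n) ℓ)))
  M = α ^ #edges (completeGraph n)
  pull : ∀ x y z → x * (y * z) ≡ y * (x * z)
  pull = solve-∀
  regroup : ∀ x y z → x * (x * (y * z)) ≡ x * (x * y) * z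
  regroup = solve-∀

theorem7 : ∃[ m ]
    ( m ∈Θ (λ n → n * ⌊log₂ n ⌋ + ⌊log₂ n ⌋ ^ 2)
    × (∀ (n : ℕ) .{{_ : NonZero n}} (α : ℕ) .{{_ : NonZero α}} → 4 ≤ⁿ α →
    1ℚᵘ - _/_ (+ 1) (n ^ 2) {{m^n≢0 n 2}}
    ≤ Pr (completeGraph n) α (canDeleteAllBut? (completeGraph n) (m n)) ) )
theorem7 = #kept , #kept∈Θ , λ n α 4≤α →
  let G    = completeGraph n
      V    = vectors α (#edges G)
      can? = canDeleteAllBut? G (#kept n)
  in 1-1/d≤g/M (n ^ 2) (length (filter can? V)) (∑ V (𝟙 ∘ ¬? ∘ can?)) (α ^ #edges G)
       {{m^n≢0 n 2}} {{m^n≢0 α (#edges G)}}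
       -- Successes and failures partition the labellings, so their numbers add up to
       -- `α ^ #edges G`.
       (trans (cong (_+ ∑ V (𝟙 ∘ ¬? ∘ can?)) (length-filter≡∑ can? V))
       (trans (sym (∑-+ V _ _))
       (trans (∑-cong V (𝟙-¬ ∘ can?)) (∑-vectors-1 α (#edges G)))))
       (#failures-≤-α^#edges n α 4≤α)
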